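{- Let $\kappa\leq\lambda$ be infinite cardinals with $\kappa$ regular. Let $\delta=\lambda^{<\kappa}$ (which is the weight of ${}^{\kappa}\lambda$), and assume $\delta>\lambda$. Then there is no continuous weak $\delta^+$-measure space $({}^{\kappa}\lambda,\mathfrak{M},\mu)$ on ${}^{\kappa}\lambda$ (for any choice of positively totally ordered monoid $\mathbb{S}$ with infinitary sum $\mathsf{Sum}$ in which $\mu$ takes its values).
   Context: **Topology.** ${}^{\kappa}\lambda$ is the set of sequences of elements of $\lambda$ of length $\kappa$, with the bounded topology, generated by the cones $\mathbf{N}_s=\{x\in{}^{\kappa}\lambda\mid s\subseteq x\}$ for $s\in{}^{<\kappa}\lambda=\bigcup_{\alpha<\kappa}{}^{\alpha}\lambda$. **Monoids and sums.** A positively totally ordered monoid is $\mathbb{S}=(S,0,+,\leq)$ where $+$ is associative (not necessarily commutative) with neutral element $0$, $\leq$ is a total order, $a\leq b$ and $c\leq d$ imply $a+c\leq b+d$, $0$ is the minimum of $\leq$, and $S\neq\{0\}$. ${}^{<\mathrm{On}}\mathbb{S}$ is the class of all sequences of elements of $S$ of ordinal length; $\mathrm{lh}(s)$ is the length of $s$. An infinitary sum on $\mathbb{S}$ is a partial function $\mathsf{Sum}:{}^{<\mathrm{On}}\mathbb{S}\to\mathbb{S}$ such that: (S1) $\mathsf{Sum}(\emptyset)=0$ and $\mathsf{Sum}(s)=s_0+\dots+s_n$ for every non-empty finite $s=(s_i)_{i\leq n}\in\mathrm{dom}(\mathsf{Sum})$; (S2) (continuity) for all $s\in\mathrm{dom}(\mathsf{Sum})$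 of limit length, if $s\restriction\alpha\in\mathrm{dom}(\mathsf{Sum})$ for cofinally many $\alpha<\mathrm{lh}(s)$, then $\mathsf{Sum}(s)=\sup\{\mathsf{Sum}(s\restriction\alpha)\mid\alpha<\mathrm{lh}(s),\ s\restriction\alpha\in\mathrm{dom}(\mathsf{Sum})\}$. **Measures.** For an infinite cardinal $\delta$, a weakly $\delta^+$-measurable space is a pair $(X,\mathfrak{M})$ where $X$ is a topological space and $\mathfrak{M}$ is a family of subsets of $X$ closed under unions of size $\leq\delta$ and containing all open subsets of $X$. A $\delta^+$-measure on it (with values in $(\mathbb{S},\mathsf{Sum})$) is a partial function $\mu:\mathscr{P}(X)\to\mathbb{S}$ with $\mathfrak{M}\subseteq\mathrm{dom}(\mu)$ such that: (M1) $\mu(\emptyset)=0$; (M2) $\mu(X)>0$; (M3) $A\subseteq B$ implies $\mu(A)\leq\mu(B)$ for all $A,B\in\mathfrak{M}$; (M4) for every family $(A_i)_{i<\gamma}$ of pairwise disjoint sets of $\mathfrak{M}$ of length an ordinal $\gamma<\delta^+$, we have $\langle\mu(A_i)\mid i<\gamma\rangle\in\mathrm{dom}(\mathsf{Sum})$ and $\mu(\bigcup_{i<\gamma}A_i)=\mathsf{Sum}(\langle\mu(A_i)\mid i<\gamma\rangle)$; (M5) for every $x\in X$ with $\{x\}\in\mathfrak{M}$ and every open local basis $\{A_i\mid i<\gamma\}$ at $x$ with $\gamma<\delta^+$, $\mu(\{x\})=\inf_{i<\gamma}\mu(A_i)$. Then $(X,\mathfrak{M},\mu)$ is called a weak $\delta^+$-measure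 space. It is continuous if $\{x\}\in\mathfrak{M}$ and $\mu(\{x\})=0$ for every $x\in X$. -}

module Defs where

open import Level using (Level; _⊔_) renaming (suc to lsuc)
open import Algebra.Bundles using (Monoid)
open import Algebra.Definitions.RawMonoid using (sum)
open import Algebra.Structures using (IsMonoid)
open import Data.Fin as Fin using (Fin)
open import Data.Product using (Σ-syntax; ∃; ∃-syntax; _×_; _,_; proj₁; proj₂)
open import Function using (_∘_; _on_; _↔_; _↣_)
open import Induction.WellFounded using (WellFounded)
open import Relation.Binary.Core using (Rel; _Preserves₂_⟶_⟶_)
open import Relation.Binary.Definitions
  using (Irrelevant; Minimum; Trichotomous; tri<; tri≈; tri>)
open import Relation.Binary.Morphism.Structures using (IsOrderIsomorphism)
open import Relation.Binary.PropositionalEquality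
  using (_≡_; _≢_; refl; cong; resp₂; isEquivalence)
open import Relation.Binary.Structures using (IsStrictTotalOrder; IsTotalOrder)
open import Relation.Nullary using (¬_)
open import Relation.Unary using (Pred; _∈_; _⊆_; _≐_; _∩_; _⊥_; ⋃; ｛_｝)
open import Relation.Unary.Polymorphic using (∅; U)
import Relation.Binary.Construct.NonStrictToStrict as ToStrict
import Relation.Binary.Construct.On as On
import Relation.Binary.Construct.StrictToNonStrict as ToNonStrict

-- The definitions are meant to be read classically, under the hypotheses
-- `∀ {a} → ExcludedMiddle a` and `∀ {a b} → Extensionality a b`, relative to a
-- universe `Set ℓ`; the letter ƛ stands for the cardinal λ.  Since
-- `ExcludedMiddle a` decides every `P : Set a` and returns an inhabitant if
-- there is one, it also supplies the axiom of choice.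
--
-- Subsets of X are predicates, identified when they have the same elements
-- (`_≐_`); partial functions are given by their graphs, so that `F x y` reads
-- "x ∈ dom F and F x = y".

-- An ordinal is a well-ordered type, and the ordinals α < γ are
-- its elements.  Irrelevance of `_<_` makes `Segment γ i` below have exactly
-- one element for each j < i, so that ^{<κ}λ has the right cardinality.

record Ordinal (ℓ : Level) : Set (lsuc ℓ) where
  infix 4 _<_
  field
    Carrier            : Set ℓ
    _<_                : Rel Carrier ℓ
    isStrictTotalOrder : IsStrictTotalOrder _≡_ _<_
    wellFounded        : WellFounded _<_
    <-irrelevant       : Irrelevant _<_

  open IsStrictTotalOrder isStrictTotalOrder public using (compare; irrefl; trans)
  open ToNonStrict _≡_ _<_ public using (_≤_)

∣_∣ : ∀ {ℓ} → Ordinal ℓ → Set ℓ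
∣_∣ = Ordinal.Carrier

Segment : ∀ {ℓ} (γ : Ordinal ℓ) → ∣ γ ∣ → Set ℓ
Segment γ i = Σ[ j ∈ ∣ γ ∣ ] Ordinal._<_ γ j i

segment : ∀ {ℓ} (γ : Ordinal ℓ) → ∣ γ ∣ → Ordinal ℓ
segment γ i = record
  { Carrier            = Segment γ i
  ; _<_                = γ._<_ on proj₁
  ; isStrictTotalOrder = record
    { isStrictPartialOrder = record
      { isEquivalence = isEquivalence
      ; irrefl        = λ { refl → γ.irrefl refl }
      ; trans         = γ.trans
      ; <-resp-≈      = resp₂ (γ._<_ on proj₁)
      }
    ; compare = cmp
    }
  ; wellFounded        = On.wellFounded proj₁ γ.wellFounded
  ; <-irrelevant       = γ.<-irrelevant
  }
  where
  module γ = Ordinal γ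

  cmp : Trichotomous _≡_ (γ._<_ on proj₁)
  cmp (j , p) (k , q) with γ.compare j k
  ... | tri< j<k j≢k j≯k   = tri< j<k (j≢k ∘ cong proj₁) j≯k
  ... | tri≈ j≮k refl j≯k  = tri≈ j≮k (cong (j ,_) (γ.<-irrelevant p q)) j≯k
  ... | tri> j≮k j≢k k<j   = tri> j≮k (j≢k ∘ cong proj₁) k<j

IsLimit : ∀ {ℓ} → Ordinal ℓ → Set ℓ
IsLimit γ = ∣ γ ∣ × (∀ i → ∃[ j ] Ordinal._<_ γ i j)

IsCardinal : ∀ {ℓ} → Ordinal ℓ → Set ℓ
IsCardinal κ = ∀ i → ¬ (∣ κ ∣ ↔ Segment κ i)

Infinite : ∀ {ℓ} → Set ℓ → Set ℓ
Infinite A = ∀ n → ¬ (A ↔ Fin n)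

-- The cofinality of κ is κ: no map from a smaller ordinal is cofinal.
IsRegular : ∀ {ℓ} → Ordinal ℓ → Set ℓ
IsRegular κ =
  ∀ i (f : Segment κ i → ∣ κ ∣) → ¬ (∀ b → ∃[ j ] Ordinal._≤_ κ b (f j))

infix 4 _≤ᶜ_ _<ᶜ_

_≤ᶜ_ : ∀ {a b} → Set a → Set b → Set (a ⊔ b)
A ≤ᶜ B = A ↣ B

_<ᶜ_ : ∀ {a b} → Set a → Set b → Set (a ⊔ b)
A <ᶜ B = (A ≤ᶜ B) × ¬ (B ≤ᶜ A)

-- The ordinals γ < δ⁺ are those of cardinality at most δ.
_<_⁺ : ∀ {ℓ} → Ordinal ℓ → Ordinal ℓ → Set ℓ
γ < δ ⁺ = ∣ γ ∣ ≤ᶜ ∣ δ ∣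

^[_]_ : ∀ {ℓ} → Ordinal ℓ → Ordinal ℓ → Set ℓ
^[ κ ] ƛ = ∣ κ ∣ → ∣ ƛ ∣

^[<_]_ : ∀ {ℓ} → Ordinal ℓ → Ordinal ℓ → Set ℓ
^[< κ ] ƛ = Σ[ α ∈ ∣ κ ∣ ] (Segment κ α → ∣ ƛ ∣)

record TopologicalSpace (ℓ o : Level) : Set (lsuc (ℓ ⊔ o)) where
  field
    Carrier : Set ℓ
    Open    : Pred (Pred Carrier ℓ) o
    resp    : ∀ {V W} → V ≐ W → Open V → Open W
    full    : Open U
    ∩-open  : ∀ {V W} → Open V → Open W → Open (V ∩ W)
    ⋃-open  : ∀ {I : Set ℓ} {V : I → Pred Carrier ℓ} →
              (∀ i → Open (V i)) → Open (⋃ I V)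

data Generated {ℓ b} {X : Set ℓ} (B : Pred (Pred X ℓ) b) :
               Pred X ℓ → Set (lsuc ℓ ⊔ b) where
  baseᵍ : ∀ {V} → B V → Generated B V
  respᵍ : ∀ {V W} → V ≐ W → Generated B V → Generated B W
  fullᵍ : Generated B U
  _∩ᵍ_  : ∀ {V W} → Generated B V → Generated B W → Generated B (V ∩ W)
  ⋃ᵍ    : ∀ {I : Set ℓ} {V : I → Pred X ℓ} →
          (∀ i → Generated B (V i)) → Generated B (⋃ I V)

generatedTopology : ∀ {ℓ b} {X : Set ℓ} → Pred (Pred X ℓ) b →
                    TopologicalSpace ℓ (lsuc ℓ ⊔ b)
generatedTopology {X = X} B = record
  { Carrier = X
  ; Open    = Generated B
  ; resp    = respᵍ
  ; full    = fullᵍ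
  ; ∩-open  = _∩ᵍ_
  ; ⋃-open  = ⋃ᵍ
  }

Cone : ∀ {ℓ} (κ ƛ : Ordinal ℓ) → ^[< κ ] ƛ → Pred (^[ κ ] ƛ) ℓ
Cone κ ƛ (α , s) x = ∀ j → x (proj₁ j) ≡ s j

IsCone : ∀ {ℓ} (κ ƛ : Ordinal ℓ) → Pred (Pred (^[ κ ] ƛ) ℓ) ℓ
IsCone κ ƛ V = ∃[ s ] V ≐ Cone κ ƛ s

boundedTopology : ∀ {ℓ} → Ordinal ℓ → Ordinal ℓ → TopologicalSpace ℓ (lsuc ℓ)
boundedTopology κ ƛ = generatedTopology (IsCone κ ƛ)

IsLocalBasis : ∀ {ℓ o} (X : TopologicalSpace ℓ o) (let open TopologicalSpace X) →
               Carrier → {I : Set ℓ} → (I → Pred Carrier ℓ) → Set (lsuc ℓ ⊔ o)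
IsLocalBasis X x A =
    (∀ i → Open (A i))
  × (∀ i → x ∈ A i)
  × (∀ V → Open V → x ∈ V → ∃[ i ] A i ⊆ V)
  where open TopologicalSpace X

record PositivelyTotallyOrderedMonoid (s r : Level) : Set (lsuc (s ⊔ r)) where
  infix  4 _≤_
  infixl 6 _+_
  field
    Carrier      : Set s
    _≤_          : Rel Carrier r
    _+_          : Carrier → Carrier → Carrier
    0#           : Carrier
    isMonoid     : IsMonoid _≡_ _+_ 0#
    isTotalOrder : IsTotalOrder _≡_ _≤_
    +-mono-≤     : _+_ Preserves₂ _≤_ ⟶ _≤_ ⟶ _≤_
    0-minimum    : Minimum _≤_ 0#
    nontrivial   : ∃[ a ] a ≢ 0#

  open ToStrict _≡_ _≤_ public using (_<_)

  monoid : Monoid s s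
  monoid = record { isMonoid = isMonoid }

  IsSup : ∀ {p} → Pred Carrier p → Carrier → Set (s ⊔ r ⊔ p)
  IsSup P b = (∀ a → P a → a ≤ b) × (∀ c → (∀ a → P a → a ≤ c) → b ≤ c)

  IsInf : ∀ {p} → Pred Carrier p → Carrier → Set (s ⊔ r ⊔ p)
  IsInf P b = (∀ a → P a → b ≤ a) × (∀ c → (∀ a → P a → c ≤ a) → c ≤ b)

Seq : ∀ ℓ {s} → Set s → Set (lsuc ℓ ⊔ s)
Seq ℓ S = Σ[ γ ∈ Ordinal ℓ ] (∣ γ ∣ → S)

_↾_ : ∀ {ℓ s} {S : Set s} (x : Seq ℓ S) → ∣ proj₁ x ∣ → Seq ℓ S
(γ , x) ↾ i = segment γ i , x ∘ proj₁

_≅ˢ_ : ∀ {ℓ s} {S : Set s} → Rel (Seq ℓ S) (ℓ ⊔ s)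
(γ , x) ≅ˢ (γ′ , x′) =
  ∃[ f ] IsOrderIsomorphism _≡_ _≡_ (Ordinal._<_ γ) (Ordinal._<_ γ′) f
       × (∀ i → x i ≡ x′ (f i))

-- `resp` is needed because an ordinal is here a well-order and not its order
-- type.  `finite` also covers n = 0, where it agrees with `empty`.

record InfinitarySum (ℓ : Level) {s r} (𝕊 : PositivelyTotallyOrderedMonoid s r)
                     (p : Level) : Set (lsuc (ℓ ⊔ p) ⊔ s ⊔ r) where
  private module S = PositivelyTotallyOrderedMonoid 𝕊
  field
    Sum        : Seq ℓ S.Carrier → S.Carrier → Set p
    functional : ∀ {x a b} → Sum x a → Sum x b → a ≡ b
    resp       : ∀ {x y a} → x ≅ˢ y → Sum x a → Sum y a

    empty      : ∀ γ (x : ∣ γ ∣ → S.Carrier) → ¬ ∣ γ ∣ → Sum (γ , x) S.0#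
    finite     : ∀ γ (x : ∣ γ ∣ → S.Carrier) n (e : Fin n → ∣ γ ∣) →
                 IsOrderIsomorphism _≡_ _≡_ Fin._<_ (Ordinal._<_ γ) e →
                 ∀ {a} → Sum (γ , x) a →
                 a ≡ sum (Monoid.rawMonoid S.monoid) (x ∘ e)
    continuity : ∀ γ (x : ∣ γ ∣ → S.Carrier) → IsLimit γ →
                 ∀ {a} → Sum (γ , x) a →
                 (∀ i → ∃[ j ] Ordinal._≤_ γ i j × ∃ (Sum ((γ , x) ↾ j))) →
                 S.IsSup (λ b → ∃[ i ] Sum ((γ , x) ↾ i) b) a

record IsWeaklyMeasurable {ℓ o m} (δ : Ordinal ℓ) (X : TopologicalSpace ℓ o)
                          (𝔐 : Pred (Pred (TopologicalSpace.Carrier X) ℓ) m) :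
                          Set (lsuc ℓ ⊔ o ⊔ m) where
  open TopologicalSpace X using (Carrier; Open)
  field
    resp     : ∀ {A B} → A ≐ B → A ∈ 𝔐 → B ∈ 𝔐
    ⋃-closed : ∀ {I : Set ℓ} → I ≤ᶜ ∣ δ ∣ → {A : I → Pred Carrier ℓ} →
               (∀ i → A i ∈ 𝔐) → ⋃ I A ∈ 𝔐
    open⊆𝔐   : Open ⊆ 𝔐

record IsWeakMeasureSpace
  {ℓ o m s r p q} (δ : Ordinal ℓ) (X : TopologicalSpace ℓ o)
  (𝕊 : PositivelyTotallyOrderedMonoid s r) (Σ𝕊 : InfinitarySum ℓ 𝕊 p)
  (𝔐 : Pred (Pred (TopologicalSpace.Carrier X) ℓ) m)
  (μ : Pred (TopologicalSpace.Carrier X) ℓ →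
       PositivelyTotallyOrderedMonoid.Carrier 𝕊 → Set q) :
  Set (lsuc ℓ ⊔ o ⊔ m ⊔ s ⊔ r ⊔ p ⊔ q) where
  open TopologicalSpace X using () renaming (Carrier to ∣X∣)
  open PositivelyTotallyOrderedMonoid 𝕊
  open InfinitarySum Σ𝕊 using (Sum)
  field
    isWeaklyMeasurable : IsWeaklyMeasurable δ X 𝔐
    functional         : ∀ {A a b} → μ A a → μ A b → a ≡ b
    resp               : ∀ {A B a} → A ≐ B → μ A a → μ B a
    𝔐⊆dom              : ∀ {A} → A ∈ 𝔐 → ∃ (μ A)

    M1 : μ ∅ 0#
    M2 : ∃[ a ] μ U a × 0# < a
    M3 : ∀ {A B a b} → A ∈ 𝔐 → B ∈ 𝔐 → A ⊆ B → μ A a → μ B b → a ≤ b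
    M4 : ∀ γ → γ < δ ⁺ → (A : ∣ γ ∣ → Pred ∣X∣ ℓ) → (∀ i → A i ∈ 𝔐) →
         (∀ {i j} → i ≢ j → A i ⊥ A j) →
         (a : ∣ γ ∣ → Carrier) → (∀ i → μ (A i) (a i)) →
         ∃[ b ] Sum (γ , a) b × μ (⋃ ∣ γ ∣ A) b
    M5 : ∀ x → ｛ x ｝ ∈ 𝔐 → ∀ γ → γ < δ ⁺ → (A : ∣ γ ∣ → Pred ∣X∣ ℓ) →
         IsLocalBasis X x A →
         ∃[ a ] μ ｛ x ｝ a × IsInf (λ b → ∃[ i ] μ (A i) b) a

IsContinuous : ∀ {ℓ m s r q} {X : Set ℓ} (𝕊 : PositivelyTotallyOrderedMonoid s r)
               (let open PositivelyTotallyOrderedMonoid 𝕊) →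
               Pred (Pred X ℓ) m → (Pred X ℓ → Carrier → Set q) → Set (ℓ ⊔ m ⊔ q)
IsContinuous 𝕊 𝔐 μ = ∀ x → ｛ x ｝ ∈ 𝔐 × μ ｛ x ｝ 0#
  where open PositivelyTotallyOrderedMonoid 𝕊

{-# OPTIONS --safe #-}
-- For κ = ω the hypothesis λ < λ^{<κ} fails, since λ · λ = λ; so κ is uncountable,
-- and by regularity every countable subset of κ is bounded.  If (ε n) satisfies
-- ε (n + 1) + ε (n + 1) ≤ ε n, the set of a with a ≤ ε n for all n is an ideal closed
-- under + and sups, so by continuity of Sum a disjoint union of at most δ sets with
-- measure in the ideal has measure in the ideal.  For ε = 0 this gives a branch x all
-- of whose cones have positive measure, and below any ε > 0 a cone at x splits off a
-- non-null set, so every ε > 0 can be halved.  Iterate from some ε 0 < μ(X); as κ is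
-- uncountable, some cone at x has positive measure η below every ε n.  By (M5) every
-- point has a cone of measure < η, so X is a disjoint union of cones with measure in
-- the ideal, whence μ(X) ≤ ε 0.
module Submission where

open import Defs
open import Axiom.ExcludedMiddle using (ExcludedMiddle)
open import Axiom.Extensionality.Propositional using (Extensionality; implicit-extensionality)
open import Data.Product using (_×_; ∃; ∃-syntax; _,_; proj₁; proj₂)
open import Function using (_↔_; _∘_; _on_; _↣_; Injection; Inverse; mk↣; mk⤖; mk↔ₛ′; case_of_)
open import Relation.Nullary using (¬_; yes; no)
open import Relation.Unary using (Pred; _∈_; _⊆_; _≐_; _∪_; _⊥_; ⋃; ｛_｝)
open import Relation.Unary.Polymorphic using (U)
open import Algebra.Structures using (IsMonoid)
open import Data.Empty using (⊥-elim) renaming (⊥ to Empty)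
open import Data.Fin as Fin using (Fin; toℕ; fromℕ<; punchOut)
open import Data.Fin.Properties
  using (injective⇒≤; toℕ-injective; punchOut-injective; fromℕ<-injective; *↔×)
open import Data.Maybe as Maybe using (Maybe; just; nothing)
open import Data.Maybe.Properties using (map-injective)
open import Data.Nat as ℕ using (ℕ; zero; suc)
import Data.Nat.Induction as ℕ
import Data.Nat.Properties as ℕ
open import Data.Product.Function.NonDependent.Propositional using (_×-↣_)
open import Data.Product.Relation.Binary.Lex.Strict using (×-Lex; ×-wellFounded)
open import Data.Sum as Sum using (_⊎_; inj₁; inj₂)
open import Function.Construct.Composition using (_↣-∘_)
open import Function.Properties.Bijection using (⤖⇒↔)
open import Function.Properties.Inverse using (↔⇒↣; ↔-sym)
open import Induction.WellFounded as WF using (WellFounded; WfRec; acc; module FixPoint)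
open import Level using (Level; lift)
open import Relation.Binary.Core using (Rel)
open import Relation.Binary.Definitions using (tri<; tri≈; tri>)
open import Relation.Binary.Morphism.Structures using (IsOrderIsomorphism)
open import Relation.Binary.PropositionalEquality hiding (resp)
open import Relation.Binary.Structures using (IsTotalOrder)
open import Relation.Nullary.Decidable using (True; toWitness; fromWitness; decidable-stable)
import Relation.Binary.Construct.On as On

open Injection using (to; injective)

private
  variable
    a b r ℓ : Level
    A : Set a
    B : Set b

-- Injections between adjoined points, finite types and segments.

Maybe-↣ : A ↣ B → Maybe A ↣ Maybe B
Maybe-↣ g = mk↣ {to = Maybe.map (to g)} (map-injective (injective g))

Maybe-Fin↣ : ∀ {n} → Maybe (Fin n) ↣ Fin (suc n)
Maybe-Fin↣ {n} = mk↣ {to = f} λ { {just _} {just _} refl → refl ; {nothing} {nothing} _ → refl }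
  where
  f : Maybe (Fin n) → Fin (suc n)
  f nothing  = Fin.zero
  f (just i) = Fin.suc i

segment↣ : (γ : Ordinal ℓ) (i : ∣ γ ∣) → Segment γ i ↣ ∣ γ ∣
segment↣ γ i = mk↣ {to = proj₁} λ
  { {j , p} {_ , q} refl → cong (j ,_) (Ordinal.<-irrelevant γ p q) }

-- The two-element ordinal, index set of a binary union.

data Two {ℓ} : Set ℓ where
  0₂ 1₂ : Two

data _<₂_ {ℓ} : Rel (Two {ℓ}) ℓ where
  0<1 : 0₂ <₂ 1₂

two : ∀ ℓ → Ordinal ℓ
two ℓ = record
  { Carrier            = Two
  ; _<_                = _<₂_
  ; isStrictTotalOrder = record
    { isStrictPartialOrder = record
      { isEquivalence = isEquivalence
      ; irrefl        = λ { refl () }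
      ; trans         = λ { 0<1 () }
      ; <-resp-≈      = resp₂ _<₂_
      }
    ; compare = λ
      { 0₂ 0₂ → tri≈ (λ ()) refl (λ ())
      ; 0₂ 1₂ → tri< 0<1 (λ ()) (λ ())
      ; 1₂ 0₂ → tri> (λ ()) (λ ()) 0<1
      ; 1₂ 1₂ → tri≈ (λ ()) refl (λ ())
      }
    }
  ; wellFounded        = λ
    { 0₂ → acc λ ()
    ; 1₂ → acc λ { 0<1 → acc λ () }
    }
  ; <-irrelevant       = λ { 0<1 0<1 → refl }
  }

Fin2→Two : ∀ {ℓ} → Fin 2 → Two {ℓ}
Fin2→Two Fin.zero    = 0₂
Fin2→Two (Fin.suc _) = 1₂

Fin2≅Two : ∀ {ℓ} → IsOrderIsomorphism _≡_ _≡_ Fin._<_ (_<₂_ {ℓ}) Fin2→Two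
Fin2≅Two = record
  { isOrderMonomorphism = record
    { isOrderHomomorphism = record
      { cong = cong Fin2→Two
      ; mono = λ { {Fin.zero} {Fin.suc _} _ → 0<1
                 ; {Fin.suc Fin.zero} {Fin.suc Fin.zero} (ℕ.s≤s ()) }
      }
    ; injective = λ { {Fin.zero} {Fin.zero} _ → refl
                    ; {Fin.suc Fin.zero} {Fin.suc Fin.zero} _ → refl }
    ; cancel    = λ { {Fin.zero} {Fin.suc _} _ → ℕ.s≤s ℕ.z≤n }
    }
  ; surjective = λ { 0₂ → Fin.zero , λ { refl → refl }
                   ; 1₂ → Fin.suc Fin.zero , λ { refl → refl } }
  }

ℕ↣⇒Two↣ : ∀ {ℓ a} {A : Set a} → ℕ ↣ A → Two {ℓ} ↣ A
ℕ↣⇒Two↣ {ℓ} e = e ↣-∘ mk↣ {to = f} λ { {0₂} {0₂} _ → refl ; {1₂} {1₂} _ → refl }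
  where
  f : Two {ℓ} → ℕ
  f 0₂ = 0
  f 1₂ = 1

-- Classical choice, minimal elements, and injections built by well-founded recursion.

module Classical (em : ∀ {a} → ExcludedMiddle a) (ext : ∀ {a b} → Extensionality a b) where

  dne : ¬ ¬ A → A
  dne = decidable-stable em

  ¬∀⇒∃¬ : {P : Pred A b} → ¬ (∀ x → P x) → ∃[ x ] ¬ P x
  ¬∀⇒∃¬ ¬∀ = dne λ ¬∃ → ¬∀ λ x → dne λ ¬p → ¬∃ (x , ¬p)

  least : (γ : Ordinal ℓ) (P : Pred ∣ γ ∣ b) → ∃ P →
          ∃[ i ] P i × (∀ j → Ordinal._<_ γ j i → ¬ P j)
  least γ P (i , p) = dne λ ¬least →
    WF.All.wfRec (Ordinal.wellFounded γ) _ (λ i → ¬ P i)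
      (λ i IH p → ¬least (i , p , λ _ → IH)) i p

  -- Map w to a value not taken by any v ≺ w.
  module _ {W : Set a} {T : Set b} {_≺_ : Rel W r} (wf : WellFounded _≺_)
           (connected : ∀ {v w} → v ≢ w → v ≺ w ⊎ w ≺ v)
           (small : ∀ w (g : T ↣ W) → ¬ (∀ t → to g t ≺ w)) where

    private
      Fresh : ∀ w → WfRec _≺_ (λ _ → T) w → T → Set _
      Fresh w IH t = ∀ {v} (v≺w : v ≺ w) → IH v≺w ≢ t

      inhabited : W → T
      inhabited w = dne λ ¬t →
        small w (mk↣ {to = λ t → ⊥-elim (¬t t)} λ {t} → ⊥-elim (¬t t)) (λ t → ⊥-elim (¬t t))

      step : ∀ w → WfRec _≺_ (λ _ → T) w → T
      step w IH = case em {P = ∃ (Fresh w IH)} of λ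
        { (yes (t , _)) → t
        -- A default that keeps the recursion total; by `some-fresh` it is never reached along `f`.
        ; (no _)        → inhabited w
        }

      open FixPoint wf (λ _ → T) step
        (λ w {IH} {IH′} IH≗IH′ → cong {A = WfRec _≺_ (λ _ → T) w} (λ IH → step w IH)
          {x = IH} {y = IH′} (implicit-extensionality ext (ext IH≗IH′)))
      open WF.All wf b

      f : W → T
      f = wfRec (λ _ → T) step

      -- If every `t` were `f v` for some `v ≺ w`, choosing such a `v` for each `t` would inject `T`
      -- into the predecessors of `w`, against `small`.
      some-fresh : ∀ w → ∃ (Fresh w (λ {v} _ → f v))
      some-fresh w = dne λ ¬fresh →
        let preimage = λ t → dne λ ¬v → ¬fresh (t , λ {v} v≺w fv≡t → ¬v (v , v≺w , fv≡t))
        in small w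
          (mk↣ {to = λ t → proj₁ (preimage t)} λ {t} {t′} e →
            trans (sym (proj₂ (proj₂ (preimage t))))
                  (trans (cong f e) (proj₂ (proj₂ (preimage t′)))))
          (λ t → proj₁ (proj₂ (preimage t)))

      step-fresh : ∀ w (IH : WfRec _≺_ (λ _ → T) w) → ∃ (Fresh w IH) → Fresh w IH (step w IH)
      step-fresh w IH fresh with em {P = ∃ (Fresh w IH)}
      ... | yes (_ , p) = p
      ... | no ¬p       = ⊥-elim (¬p fresh)

      f-fresh : ∀ {v w} → v ≺ w → f v ≢ f w
      f-fresh {w = w} v≺w e =
        step-fresh w (λ {v} _ → f v) (some-fresh w) v≺w (trans e unfold-wfRec)

    wellFounded↣ : W ↣ T
    wellFounded↣ = mk↣ {to = f} λ {v} {w} e → dne λ v≢w → case connected v≢w of λ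
      { (inj₁ v≺w) → f-fresh v≺w e
      ; (inj₂ w≺v) → f-fresh w≺v (sym e)
      }

  -- Finite and infinite types.

  ↣Fin⇒↔Fin : ∀ {n} → A ↣ Fin n → ∃[ m ] A ↔ Fin m
  ↣Fin⇒↔Fin {n = n} g with em {P = ∀ i → ∃[ x ] to g x ≡ i}
  ... | yes surj = n , ⤖⇒↔ (mk⤖ (injective g ,
                     λ i → proj₁ (surj i) , λ { refl → proj₂ (surj i) }))
  ... | no ¬surj with ¬∀⇒∃¬ ¬surj
  -- Deleting the missed value `i` lowers `n` by one.
  ↣Fin⇒↔Fin {n = suc n} g | no _ | i , missed = ↣Fin⇒↔Fin {n = n}
    (mk↣ {to = λ x → punchOut {i = i} λ e → missed (x , sym e)} λ e →
      injective g (punchOut-injective {i = i} _ _ e))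

  -- Recursion along ℕ never runs out of fresh values: an injection of `A` into the numbers below
  -- `n` would make `A` finite.
  infinite⇒ℕ↣ : Infinite A → ℕ ↣ A
  infinite⇒ℕ↣ inf = wellFounded↣ ℕ.<-wellFounded
    (λ {m} {n} m≢n → case ℕ.<-cmp m n of λ
      { (tri< m<n _ _) → inj₁ m<n
      ; (tri≈ _ m≡n _) → ⊥-elim (m≢n m≡n)
      ; (tri> _ _ n<m) → inj₂ n<m
      })
    λ n g bounded → let m , e = ↣Fin⇒↔Fin {n = n} (mk↣ {to = λ x → fromℕ< (bounded x)}
                                  λ e → injective g (fromℕ<-injective _ _ _ _ e))
                    in inf m e

  ℕ↣⇒infinite : ℕ ↣ A → Infinite A
  ℕ↣⇒infinite g n e = ℕ.1+n≰n (injective⇒≤ (injective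
    (↔⇒↣ e ↣-∘ (g ↣-∘ mk↣ {to = toℕ {suc n}} toℕ-injective))))

  Maybe↣ : ℕ ↣ A → (A × A) ↣ A → Maybe A ↣ A
  Maybe↣ {A = A} e pair = pair ↣-∘ mk↣ {to = f} inj
    where
    f : Maybe A → A × A
    f nothing  = to e 0 , to e 0
    f (just x) = to e 1 , x

    inj : ∀ {x y} → f x ≡ f y → x ≡ y
    inj {just _}  {just _}  eq = cong (just ∘ proj₂) eq
    inj {just _}  {nothing} eq = case injective e (cong proj₁ eq) of λ ()
    inj {nothing} {just _}  eq = case injective e (cong proj₁ eq) of λ ()
    inj {nothing} {nothing} eq = refl

  -- Squares of infinite ordinals, by Gödel's pairing argument.

  module _ (γ : Ordinal ℓ) where
    open Ordinal γ

    private
      SquareBelow : Pred ∣ γ ∣ ℓ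
      SquareBelow i = ℕ ↣ Segment γ i → (Segment γ i × Segment γ i) ↣ Segment γ i

      max : ∣ γ ∣ → ∣ γ ∣ → ∣ γ ∣
      max i j = case compare i j of λ { (tri< _ _ _) → j ; (tri≈ _ _ _) → j ; (tri> _ _ _) → i }

      i≤max : ∀ i j → i ≤ max i j
      i≤max i j with compare i j
      ... | tri< i<j _ _ = inj₁ i<j
      ... | tri≈ _ i≡j _ = inj₂ i≡j
      ... | tri> _ _ _   = inj₂ refl

      j≤max : ∀ i j → j ≤ max i j
      j≤max i j with compare i j
      ... | tri< _ _ _   = inj₂ refl
      ... | tri≈ _ _ _   = inj₂ refl
      ... | tri> _ _ j<i = inj₁ j<i

      ≤-trans : ∀ {i j k} → i ≤ j → j ≤ k → i ≤ k
      ≤-trans (inj₁ p)    (inj₁ q)    = inj₁ (trans< p q)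
        where trans< = Ordinal.trans γ
      ≤-trans (inj₁ p)    (inj₂ refl) = inj₁ p
      ≤-trans (inj₂ refl) q           = q

      connected : ∀ {i j} → i ≢ j → i < j ⊎ j < i
      connected {i} {j} i≢j with compare i j
      ... | tri< p _ _ = inj₁ p
      ... | tri≈ _ p _ = ⊥-elim (i≢j p)
      ... | tri> _ _ p = inj₂ p

      -- Gödel's well-order of γ × γ.
      key : ∣ γ ∣ × ∣ γ ∣ → ∣ γ ∣ × ∣ γ ∣ × ∣ γ ∣
      key (i , j) = max i j , i , j

      _≺_ : Rel (∣ γ ∣ × ∣ γ ∣) ℓ
      _≺_ = ×-Lex _≡_ _<_ (×-Lex _≡_ _<_ _<_) on key

      ≺-wellFounded : WellFounded _≺_
      ≺-wellFounded = On.wellFounded key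
        (×-wellFounded wellFounded (×-wellFounded wellFounded wellFounded))

      ≺-connected : ∀ {p q} → p ≢ q → p ≺ q ⊎ q ≺ p
      ≺-connected {i , j} {i′ , j′} p≢q
        with em {P = max i j ≡ max i′ j′} | em {P = i ≡ i′}
      ... | no m≢m′ | _ = Sum.map inj₁ inj₁ (connected m≢m′)
      ... | yes m≡m′ | no i≢i′ =
        Sum.map (λ e → inj₂ (m≡m′ , inj₁ e)) (λ e → inj₂ (sym m≡m′ , inj₁ e)) (connected i≢i′)
      ... | yes m≡m′ | yes refl =
        Sum.map (λ e → inj₂ (m≡m′ , inj₂ (refl , e))) (λ e → inj₂ (sym m≡m′ , inj₂ (refl , e)))
          (connected λ { refl → p≢q refl })

      -- `Maybe (Segment γ m)` encodes the closed segment of all `i ≤ m`, with `nothing` standing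
      -- for `m` itself.
      below : ∀ {m i} → i ≤ m → Maybe (Segment γ m)
      below {i = i} (inj₁ i<m) = just (i , i<m)
      below         (inj₂ _)   = nothing

      below-injective : ∀ {m i j} (p : i ≤ m) (q : j ≤ m) → below p ≡ below q → i ≡ j
      below-injective (inj₁ _)    (inj₁ _)    refl = refl
      below-injective (inj₂ refl) (inj₂ refl) _    = refl

      ≺⇒max≤ : ∀ {p q} → p ≺ q → max (proj₁ p) (proj₂ p) ≤ max (proj₁ q) (proj₂ q)
      ≺⇒max≤ (inj₁ lt)       = inj₁ lt
      ≺⇒max≤ (inj₂ (eq , _)) = inj₂ eq

    -- If γ injects into a proper segment, the pairing there is pulled back. Otherwise it suffices
    -- that γ does not inject into the Gödel predecessors of a pair `q`; these lie in the square of
    -- a closed segment.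
    square-step : (∀ i → SquareBelow i) → ℕ ↣ ∣ γ ∣ → (∣ γ ∣ × ∣ γ ∣) ↣ ∣ γ ∣
    square-step IH e with em {P = ∃[ i ] ∣ γ ∣ ↣ Segment γ i}
    ... | yes (i , g) = segment↣ γ i ↣-∘ (IH i (g ↣-∘ e) ↣-∘ (g ×-↣ g))
    ... | no ¬small = wellFounded↣ ≺-wellFounded ≺-connected small
      where
      small : ∀ q (g : ∣ γ ∣ ↣ (∣ γ ∣ × ∣ γ ∣)) → ¬ (∀ i → to g i ≺ q)
      small q g g≺q = case em {P = ℕ ↣ Segment γ m} of λ
        -- For infinite `Segment γ m`, adding a point and squaring keep the size, so γ would inject
        -- into `Segment γ m`.
        { (yes e′) → let s = IH m e′ ; s′ = Maybe↣ e′ s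
                     in ¬small (m , s ↣-∘ ((s′ ×-↣ s′) ↣-∘ h))
        -- For finite `Segment γ m`, γ itself would be finite.
        ; (no ¬e′) → let n , f = ¬∀⇒∃¬ (λ inf → ¬e′ (infinite⇒ℕ↣ inf))
                         f′ = Maybe-Fin↣ ↣-∘ Maybe-↣ (↔⇒↣ (dne f))
                         n′ , k = ↣Fin⇒↔Fin (↔⇒↣ (↔-sym *↔×) ↣-∘ ((f′ ×-↣ f′) ↣-∘ h))
                     in ℕ↣⇒infinite e n′ k
        }
        where
        m = max (proj₁ q) (proj₂ q)

        fst≤ : ∀ i → proj₁ (to g i) ≤ m
        fst≤ i = ≤-trans (i≤max _ _) (≺⇒max≤ (g≺q i))

        snd≤ : ∀ i → proj₂ (to g i) ≤ m
        snd≤ i = ≤-trans (j≤max _ _) (≺⇒max≤ (g≺q i))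

        h : ∣ γ ∣ ↣ (Maybe (Segment γ m) × Maybe (Segment γ m))
        h = mk↣ {to = λ i → below (fst≤ i) , below (snd≤ i)} λ {i} {j} eq →
          injective g (cong₂ _,_
            (below-injective (fst≤ i) (fst≤ j) (cong proj₁ eq))
            (below-injective (snd≤ i) (snd≤ j) (cong proj₂ eq)))

  flatten : (γ : Ordinal ℓ) {i : ∣ γ ∣} (j : Segment γ i) →
            Segment (segment γ i) j ↔ Segment γ (proj₁ j)
  flatten γ {i} (j , j<i) = mk↔ₛ′
    (λ { ((k , _) , k<j) → k , k<j })
    (λ { (k , k<j) → (k , Ordinal.trans γ k<j j<i) , k<j })
    (λ _ → refl)
    (λ { ((k , k<i) , k<j) → cong (λ p → (k , p) , k<j) (Ordinal.<-irrelevant γ _ _) })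

  -- Induction on the segments of γ; `flatten` identifies a segment of a segment with a segment of
  -- γ, where the induction hypothesis lives.
  square↣ : (γ : Ordinal ℓ) → ℕ ↣ ∣ γ ∣ → (∣ γ ∣ × ∣ γ ∣) ↣ ∣ γ ∣
  square↣ γ = square-step γ (WF.All.wfRec (Ordinal.wellFounded γ) _ _ λ i IH →
    square-step (segment γ i) λ { j@(_ , j<i) e →
      let out = ↔⇒↣ (flatten γ j)
      in ↔⇒↣ (↔-sym (flatten γ j)) ↣-∘ (IH j<i (out ↣-∘ e) ↣-∘ (out ×-↣ out)) })

  -- The size of `^[< κ ] ƛ`, and boundedness of countable subsets of κ.

  Fin→↣ : A → (A × A) ↣ A → ∀ n → (Fin n → A) ↣ A
  Fin→↣ x pair zero    = mk↣ {to = λ _ → x} λ _ → ext λ ()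
  Fin→↣ x pair (suc n) = mk↣ {to = λ s → to pair (s Fin.zero , to rest (s ∘ Fin.suc))} λ e →
    ext λ { Fin.zero    → cong proj₁ (injective pair e)
          ; (Fin.suc i) → cong (λ f → f i) (injective rest (cong proj₂ (injective pair e))) }
    where
    rest = Fin→↣ x pair n

  module _ (κ ƛ : Ordinal ℓ) (κ≤ƛ : ∣ κ ∣ ≤ᶜ ∣ ƛ ∣) (e : ℕ ↣ ∣ ƛ ∣) where

    -- A sequence is then a finite tuple, coded by one element of λ; paired with its length, viewed
    -- in λ through `κ≤ƛ`, it is determined.
    finite-segments⇒^<↣ : (∀ α → ¬ Infinite (Segment κ α)) → (^[< κ ] ƛ) ↣ ∣ ƛ ∣
    finite-segments⇒^<↣ fin =
      mk↣ {to = λ (α , s) → to pair (to κ≤ƛ α , code α s)} λ {t} {t′} eq →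
        inj t t′ (cong proj₁ (injective pair eq)) (cong proj₂ (injective pair eq))
      where
      pair = square↣ ƛ e
  
      size : ∀ α → ∃[ n ] Segment κ α ↔ Fin n
      size α = let n , p = ¬∀⇒∃¬ (fin α) in n , dne p

      index : ∀ α → Segment κ α ↔ Fin (proj₁ (size α))
      index α = proj₂ (size α)

      code : ∀ α → (Segment κ α → ∣ ƛ ∣) → ∣ ƛ ∣
      code α s = to (Fin→↣ (to e 0) pair _) (s ∘ Inverse.from (index α))

      inj : ∀ t t′ → to κ≤ƛ (proj₁ t) ≡ to κ≤ƛ (proj₁ t′) →
            code (proj₁ t) (proj₂ t) ≡ code (proj₁ t′) (proj₂ t′) → t ≡ t′
      inj (α , s) (α′ , s′) p q with injective κ≤ƛ p
      ... | refl = cong (α ,_) (ext λ j → begin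
        s j                          ≡⟨ cong s (Inverse.strictlyInverseʳ (index α) j) ⟨
        s (from′ (to′ j))            ≡⟨ cong (λ f → f (to′ j))
                                             (injective (Fin→↣ (to e 0) pair _) q) ⟩
        s′ (from′ (to′ j))           ≡⟨ cong s′ (Inverse.strictlyInverseʳ (index α) j) ⟩
        s′ j                         ∎)
        where
        open ≡-Reasoning
        to′ = Inverse.to (index α)
        from′ = Inverse.from (index α)

    infinite-segment : ¬ ((^[< κ ] ƛ) ↣ ∣ ƛ ∣) → ∃[ α ] ℕ ↣ Segment κ α
    infinite-segment ^<≰ƛ = dne λ ¬inf → ^<≰ƛ
      (finite-segments⇒^<↣ λ α inf → ¬inf (α , infinite⇒ℕ↣ inf))

  -- The sequence `f` is spread over `Segment κ α` along `e`; by regularity the resulting map is not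
  -- cofinal.
  regular⇒bounded : (κ : Ordinal ℓ) → IsRegular κ → ∀ {α} → ℕ ↣ Segment κ α →
                    (f : ℕ → ∣ κ ∣) → ∃[ b ] (∀ n → Ordinal._<_ κ (f n) b)
  regular⇒bounded κ regular {α} e f = let b , ¬b≤ = ¬∀⇒∃¬ (regular α f′) in b , λ n →
      subst (λ i → i < b) (f′∘e n) (≰⇒> λ b≤ → ¬b≤ (to e n , b≤))
    where
    open Ordinal κ
    f′ : Segment κ α → ∣ κ ∣
    -- The default `f 0` adds no new value to the range.
    f′ j = case em {P = ∃[ n ] to e n ≡ j} of λ { (yes (n , _)) → f n ; (no _) → f 0 }

    f′∘e : ∀ n → f′ (to e n) ≡ f n
    f′∘e n with em {P = ∃[ m ] to e m ≡ to e n}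
    ... | yes (m , eq) = cong f (injective e eq)
    ... | no ¬p        = ⊥-elim (¬p (n , refl))

    ≰⇒> : ∀ {i j} → ¬ (j ≤ i) → i < j
    ≰⇒> {i} {j} j≰i with compare i j
    ... | tri< p _ _ = p
    ... | tri≈ _ p _ = ⊥-elim (j≰i (inj₂ (sym p)))
    ... | tri> _ _ p = ⊥-elim (j≰i (inj₁ p))

  -- Order and finite additivity in a weak measure space.

  module WeakMeasure
    {ℓ o m s r p q} {δ : Ordinal ℓ} (ℕ≤δ : ℕ ↣ ∣ δ ∣) {X : TopologicalSpace ℓ o}
    {𝕊 : PositivelyTotallyOrderedMonoid s r} {Σ𝕊 : InfinitarySum ℓ 𝕊 p}
    {𝔐 : Pred (Pred (TopologicalSpace.Carrier X) ℓ) m}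
    {μ : Pred (TopologicalSpace.Carrier X) ℓ →
         PositivelyTotallyOrderedMonoid.Carrier 𝕊 → Set q}
    (space : IsWeakMeasureSpace δ X 𝕊 Σ𝕊 𝔐 μ) where

    open TopologicalSpace X using () renaming (Carrier to ∣X∣)
    open PositivelyTotallyOrderedMonoid 𝕊
    open IsMonoid isMonoid using (identityʳ)
    open IsTotalOrder isTotalOrder public using (total; antisym; reflexive)
      renaming (trans to ≤-trans)
    open InfinitarySum Σ𝕊 using (Sum; finite; continuity) renaming (functional to Sum-functional)
    open IsWeakMeasureSpace space
    open IsWeaklyMeasurable isWeaklyMeasurable using (⋃-closed)

    ≤0⇒≡0 : ∀ {a} → a ≤ 0# → a ≡ 0#
    ≤0⇒≡0 a≤0 = antisym a≤0 (0-minimum _)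

    ≢0⇒0< : ∀ {a} → a ≢ 0# → 0# < a
    ≢0⇒0< a≢0 = 0-minimum _ , a≢0 ∘ sym

    ≰⇒> : ∀ {a b} → ¬ a ≤ b → b < a
    ≰⇒> {a} {b} a≰b = case total a b of λ
      { (inj₁ a≤b) → ⊥-elim (a≰b a≤b)
      ; (inj₂ b≤a) → b≤a , λ b≡a → a≰b (reflexive (sym b≡a))
      }

    μ-empty : ∀ {A a} → ¬ ∃ A → μ A a → a ≡ 0#
    μ-empty empty μA = sym (functional M1 (resp ((λ x∈A → ⊥-elim (empty (_ , x∈A))) , λ ()) μA))

    μ-∪ : ∀ {A B a b} → A ∈ 𝔐 → B ∈ 𝔐 → A ⊥ B → μ A a → μ B b → μ (A ∪ B) (a + b)
    μ-∪ {A} {B} {a} {b} A∈𝔐 B∈𝔐 A⊥B μA μB =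
      let c , Σc , μc = M4 (two ℓ) (ℕ↣⇒Two↣ ℕ≤δ) F
                          (λ { 0₂ → A∈𝔐 ; 1₂ → B∈𝔐 }) disjoint f (λ { 0₂ → μA ; 1₂ → μB })
      in subst (μ (A ∪ B))
           -- The finite sum unfolds to `a + (b + 0#)`.
           (trans (finite (two ℓ) f 2 Fin2→Two Fin2≅Two Σc) (cong (a +_) (identityʳ b)))
           (resp ((λ { (0₂ , x∈A) → inj₁ x∈A ; (1₂ , x∈B) → inj₂ x∈B })
                 , λ { (inj₁ x∈A) → 0₂ , x∈A ; (inj₂ x∈B) → 1₂ , x∈B }) μc)
      where
      F : Two → Pred ∣X∣ ℓ
      F 0₂ = A
      F 1₂ = B

      f : Two → Carrier
      f 0₂ = a
      f 1₂ = b

      disjoint : ∀ {i j} → i ≢ j → F i ⊥ F j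
      disjoint {0₂} {0₂} i≢j = ⊥-elim (i≢j refl)
      disjoint {0₂} {1₂} _   = A⊥B
      disjoint {1₂} {0₂} _   = λ (x∈B , x∈A) → A⊥B (x∈A , x∈B)
      disjoint {1₂} {1₂} i≢j = ⊥-elim (i≢j refl)

    -- The ideal of a halving sequence, and disjoint unions of small sets.

    module Halving (ε : ℕ → Carrier) (halving : ∀ n → ε (suc n) + ε (suc n) ≤ ε n) where

      Small : Carrier → Set r
      Small a = ∀ n → a ≤ ε n

      0-small : Small 0#
      0-small n = 0-minimum _

      +-small : ∀ {a b} → Small a → Small b → Small (a + b)
      +-small a-small b-small n =
        ≤-trans (+-mono-≤ (a-small (suc n)) (b-small (suc n))) (halving n)

      module _ (γ : Ordinal ℓ) (γ<δ⁺ : γ < δ ⁺) (A : ∣ γ ∣ → Pred ∣X∣ ℓ) (A∈𝔐 : ∀ i → A i ∈ 𝔐)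
               (disjoint : ∀ {i j} → i ≢ j → A i ⊥ A j)
               (a : ∣ γ ∣ → Carrier) (μA : ∀ i → μ (A i) (a i))
               (a-small : ∀ i → Small (a i)) where

        private
          Below : ∣ γ ∣ → Pred ∣X∣ ℓ
          Below i = ⋃ (Segment γ i) (A ∘ proj₁)

          disjoint-segment : ∀ {i} {j k : Segment γ i} → j ≢ k → A (proj₁ j) ⊥ A (proj₁ k)
          disjoint-segment {i} j≢k = disjoint (j≢k ∘ injective (segment↣ γ i))

        -- At limit length, continuity makes the sum the supremum of the measures of the partial
        -- unions, which lie below every `ε n`. At successor length, where continuity says nothing,
        -- the last set is split off by finite additivity of μ.
        ⋃-small-step : (∀ i {b} → μ (Below i) b → Small b) → ∀ {b} → μ (⋃ ∣ γ ∣ A) b → Small b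
        ⋃-small-step IH {b} μb with em {P = ∣ γ ∣} | em {P = ∀ i → ∃[ j ] Ordinal._<_ γ i j}
        ... | no empty | _ = subst Small (sym (μ-empty (λ (_ , i , _) → empty i) μb)) 0-small
        -- Applying M4 to every proper segment puts every restriction of `a` into the domain of
        -- `Sum`, as continuity requires.
        ... | yes i₀ | yes limit =
          let c , Σc , μc = M4 γ γ<δ⁺ A A∈𝔐 disjoint a μA
              partial = λ i → M4 (segment γ i) (γ<δ⁺ ↣-∘ segment↣ γ i) (A ∘ proj₁) (A∈𝔐 ∘ proj₁)
                                 disjoint-segment (a ∘ proj₁) (μA ∘ proj₁)
              _ , below-bound = continuity γ a (i₀ , limit) Σc
                (λ i → i , inj₂ refl , proj₁ (partial i) , proj₁ (proj₂ (partial i)))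
          in λ n → subst (_≤ ε n) (functional μc μb) (below-bound (ε n) λ d (i , Σd) →
               let _ , Σd′ , μd′ = partial i
               in IH i (subst (μ (Below i)) (Sum-functional Σd′ Σd) μd′) n)
        ... | yes _ | no ¬limit =
          let i , top = ¬∀⇒∃¬ ¬limit
              below∈𝔐 = ⋃-closed (γ<δ⁺ ↣-∘ segment↣ γ i) (A∈𝔐 ∘ proj₁)
              c , μc = 𝔐⊆dom below∈𝔐
              μ∪ = μ-∪ below∈𝔐 (A∈𝔐 i)
                (λ (((j , j<i) , x∈Aj) , x∈Ai) →
                  disjoint (λ { refl → Ordinal.irrefl γ refl j<i }) (x∈Aj , x∈Ai))
                μc (μA i)
          in subst Small (functional (resp
               ( (λ { (inj₁ ((j , _) , x∈Aj)) → j , x∈Aj ; (inj₂ x∈Ai) → i , x∈Ai })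
               , λ { (j , x∈Aj) → case Ordinal.compare γ j i of λ
                     { (tri< j<i _ _)  → inj₁ ((j , j<i) , x∈Aj)
                     ; (tri≈ _ refl _) → inj₂ x∈Aj
                     ; (tri> _ _ i<j)  → ⊥-elim (top (j , i<j)) } }) μ∪) μb)
               (+-small (IH i μc) (a-small i))

      -- Well-founded induction on `i` treats the unions over proper segments; one more step then
      -- reaches γ.
      ⋃-small : (γ : Ordinal ℓ) → γ < δ ⁺ → (A : ∣ γ ∣ → Pred ∣X∣ ℓ) (A∈𝔐 : ∀ i → A i ∈ 𝔐) →
                (∀ {i j} → i ≢ j → A i ⊥ A j) →
                (∀ i {a} → μ (A i) a → Small a) →
                ∀ {b} → μ (⋃ ∣ γ ∣ A) b → Small b
      ⋃-small γ γ<δ⁺ A A∈𝔐 disjoint A-small =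
        ⋃-small-step γ γ<δ⁺ A A∈𝔐 disjoint (proj₁ ∘ μA) (proj₂ ∘ μA)
          (λ i → A-small i (proj₂ (μA i)))
          (WF.All.wfRec (Ordinal.wellFounded γ) _
            (λ i → ∀ {b} → μ (⋃ (Segment γ i) (A ∘ proj₁)) b → Small b)
            λ i IH → ⋃-small-step (segment γ i) (γ<δ⁺ ↣-∘ segment↣ γ i) (A ∘ proj₁) (A∈𝔐 ∘ proj₁)
              (λ j≢k → disjoint (j≢k ∘ injective (segment↣ γ i)))
              (proj₁ ∘ μA ∘ proj₁) (proj₂ ∘ μA ∘ proj₁) (λ (j , _) → A-small j (proj₂ (μA j)))
              λ (j , j<i) μb → IH j<i (resp
                ( (λ { (((k , _) , k<j) , x∈Ak) → (k , k<j) , x∈Ak })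
                , λ { ((k , k<j) , x∈Ak) → ((k , Ordinal.trans γ k<j j<i) , k<j) , x∈Ak }) μb))
        where
        μA : ∀ i → ∃ (μ (A i))
        μA i = 𝔐⊆dom (A∈𝔐 i)

  -- Cones, open sets and small neighbourhoods in the bounded topology.

  module NoMeasure
    {ℓ} (κ ƛ δ : Ordinal ℓ) (κ≤δ : ∣ κ ∣ ≤ᶜ ∣ δ ∣) (ℕ≤δ : ℕ ↣ ∣ δ ∣) (α₀ : ∣ κ ∣)
    (bounded : (f : ℕ → ∣ κ ∣) → ∃[ b ] (∀ n → Ordinal._<_ κ (f n) b))
    (enum : ∣ δ ∣ ↔ (^[< κ ] ƛ))
    {s r p m q} {𝕊 : PositivelyTotallyOrderedMonoid s r} {Σ𝕊 : InfinitarySum ℓ 𝕊 p}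
    {𝔐 : Pred (Pred (^[ κ ] ƛ) ℓ) m}
    {μ : Pred (^[ κ ] ƛ) ℓ → PositivelyTotallyOrderedMonoid.Carrier 𝕊 → Set q}
    (space : IsWeakMeasureSpace δ (boundedTopology κ ƛ) 𝕊 Σ𝕊 𝔐 μ)
    (continuous : IsContinuous 𝕊 𝔐 μ) where

    open TopologicalSpace (boundedTopology κ ƛ) using (Open)
    open PositivelyTotallyOrderedMonoid 𝕊
    open IsMonoid isMonoid using (identityˡ)
    open IsWeakMeasureSpace space
    open IsWeaklyMeasurable isWeaklyMeasurable using (open⊆𝔐)
    open WeakMeasure ℕ≤δ space
    module κ = Ordinal κ

    _↾ˣ_ : ^[ κ ] ƛ → ∣ κ ∣ → ^[< κ ] ƛ
    x ↾ˣ α = α , x ∘ proj₁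

    N : ^[ κ ] ƛ → ∣ κ ∣ → Pred (^[ κ ] ƛ) ℓ
    N x α = Cone κ ƛ (x ↾ˣ α)

    Cone-open : ∀ t → Open (Cone κ ƛ t)
    Cone-open t = baseᵍ (t , (λ z → z) , (λ z → z))

    locally-open : ∀ {V} → (∀ {x} → x ∈ V → ∃[ α ] N x α ⊆ V) → Open V
    locally-open {V} nbhd = respᵍ
      ( (λ ((x , x∈V) , y∈N) → proj₂ (nbhd x∈V) y∈N)
      , λ {x} x∈V → (x , x∈V) , λ _ → refl)
      (⋃ᵍ {I = ∃ V} λ (x , x∈V) → Cone-open (x ↾ˣ proj₁ (nbhd x∈V)))

    N-antitone : ∀ {x α β} → α κ.< β → N x β ⊆ N x α
    N-antitone α<β y∈N (γ , γ<α) = y∈N (γ , κ.trans γ<α α<β)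

    open⇒nbhd : ∀ {V x} → Open V → x ∈ V → ∃[ α ] N x α ⊆ V
    open⇒nbhd (baseᵍ ((α , s) , V⊆ , ⊆V)) x∈V = α , λ y∈N → ⊆V λ j → trans (y∈N j) (V⊆ x∈V j)
    open⇒nbhd (respᵍ (V⊆W , W⊆V) open-V) x∈W =
      let α , N⊆V = open⇒nbhd open-V (W⊆V x∈W) in α , V⊆W ∘ N⊆V
    open⇒nbhd fullᵍ _ = α₀ , λ _ → lift _
    open⇒nbhd {x = x} (open-V ∩ᵍ open-W) (x∈V , x∈W) =
      let α , N⊆V = open⇒nbhd open-V x∈V
          β , N⊆W = open⇒nbhd open-W x∈W
          -- Bounding the sequence α, β, β, ... gives a γ strictly above both.
          γ , <γ = bounded λ { zero → α ; (suc _) → β }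
      in γ , λ y∈N → N⊆V (N-antitone {x} (<γ 0) y∈N) , N⊆W (N-antitone {x} (<γ 1) y∈N)
    open⇒nbhd (⋃ᵍ open-V) (i , x∈Vi) =
      let α , N⊆V = open⇒nbhd (open-V i) x∈Vi in α , λ y∈N → i , N⊆V y∈N

    μ-open : ∀ {V} → Open V → ∃ (μ V)
    μ-open open-V = 𝔐⊆dom (open⊆𝔐 open-V)

    value : ^[< κ ] ƛ → Carrier
    value t = proj₁ (μ-open (Cone-open t))

    μ-value : ∀ t → μ (Cone κ ƛ t) (value t)
    μ-value t = proj₂ (μ-open (Cone-open t))

    -- The cones at `x` form a local basis of size κ ≤ δ, so by M5 their measures have infimum 0;
    -- without a cone below ε, ε would be a lower bound.
    small-cone : ∀ x {ε} → 0# < ε → ∃[ α ] value (x ↾ˣ α) < ε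
    small-cone x {ε} (0≤ε , 0≢ε) =
      let a , μa , _ , greatest = M5 x (proj₁ (continuous x)) κ κ≤δ (N x)
            ((λ α → Cone-open (x ↾ˣ α)) , (λ _ _ → refl) , λ _ → open⇒nbhd)
      in dne λ ¬small → 0≢ε (antisym 0≤ε (subst (ε ≤_) (functional μa (proj₂ (continuous x)))
           (greatest ε λ b (α , μb) → dne λ ε≰b →
             ¬small (α , subst (_< ε) (functional μb (μ-value (x ↾ˣ α))) (≰⇒> ε≰b)))))

    mono-open : ∀ {V W a b} → Open V → Open W → V ⊆ W → μ V a → μ W b → a ≤ b
    mono-open open-V open-W = M3 (open⊆𝔐 open-V) (open⊆𝔐 open-W)

    -- Partition of the space into small cones.

    module _ (ε : ℕ → Carrier) (halving : ∀ n → ε (suc n) + ε (suc n) ≤ ε n) where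
      open Halving ε halving

      -- The cones N x α with α least such that the measure of N x α is small
      -- form a partition.
      cover-small : (∀ x → ∃[ α ] Small (value (x ↾ˣ α))) → ∀ {b} → μ U b → Small b
      -- Pieces are indexed by all of `^[< κ ] ƛ`, enumerated by δ; those without a minimal small
      -- cone are empty.
      cover-small cover μU = ⋃-small δ (mk↣ λ e → e) (Piece ∘ Inverse.to enum)
          (λ i → open⊆𝔐 (Piece-open (Inverse.to enum i)))
          (λ i≢j → disjoint (i≢j ∘ injective (↔⇒↣ enum)))
          (λ i → Piece-small (Inverse.to enum i))
          (resp ((λ {x} _ → let t , x∈P = in-piece x
                            in Inverse.from enum t ,
                               subst (λ t → x ∈ Piece t) (sym (Inverse.strictlyInverseˡ enum t)) x∈P)
                , λ _ → lift _) μU)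
        where
        -- `True` brings smallness down to the universe of the points.
        Good : ^[< κ ] ƛ → Set
        Good t = True (em {P = Small (value t)})

        Piece : ^[< κ ] ƛ → Pred (^[ κ ] ƛ) ℓ
        Piece t x = x ∈ Cone κ ƛ t × Good t × (∀ β → β κ.< proj₁ t → ¬ Good (x ↾ˣ β))

        ↾ˣ-cong : ∀ {x y α} → y ∈ N x α → y ↾ˣ α ≡ x ↾ˣ α
        ↾ˣ-cong {α = α} y∈N = cong (α ,_) (ext y∈N)

        -- All points of a cone share their shorter restrictions, so minimality holds for all of
        -- them or for none: the piece is the whole cone or empty.
        Piece-open : ∀ t → Open (Piece t)
        Piece-open t@(α , s) = locally-open λ {x} (x∈C , good , least) →
          α , λ {y} y∈N → (λ j → trans (y∈N j) (x∈C j)) , good , λ β β<α good′ →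
            least β β<α (subst Good (↾ˣ-cong {x} {y} (N-antitone {x} β<α y∈N)) good′)

        Piece-small : ∀ t {a} → μ (Piece t) a → Small a
        Piece-small t {a} μa with em {P = ∃ (Piece t)}
        ... | yes (_ , _ , good , _) = λ n → ≤-trans
          (mono-open (Piece-open t) (Cone-open t) proj₁ μa (μ-value t)) (toWitness good n)
        ... | no empty = subst Small (sym (μ-empty empty μa)) 0-small

        in-piece : ∀ x → ∃[ t ] x ∈ Piece t
        in-piece x =
          let α , small = cover x
              β , good , minimal = least κ (λ α → Good (x ↾ˣ α)) (α , fromWitness small)
          in x ↾ˣ β , (λ _ → refl) , good , minimal

        disjoint : ∀ {t t′} → t ≢ t′ → Piece t ⊥ Piece t′
        disjoint {α , s} {β , s′} t≢t′ {x} ((x∈C , good , minimal) , (x∈C′ , good′ , minimal′))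
          with κ.compare α β
        ... | tri< α<β _ _  = minimal′ α α<β (subst Good (cong (α ,_) (sym (ext x∈C))) good)
        ... | tri≈ _ refl _ = t≢t′ (cong (α ,_) (ext λ j → trans (sym (x∈C j)) (x∈C′ j)))
        ... | tri> _ _ β<α  = minimal β β<α (subst Good (cong (β ,_) (sym (ext x∈C′))) good′)

    -- The null ideal, given by the constant sequence 0, and a branch of non-null cones.

    0-halving : ∀ (n : ℕ) → 0# + 0# ≤ 0#
    0-halving _ = reflexive (identityˡ 0#)

    -- Otherwise the null cones would cover the space.
    positive-branch : ∃[ x ] (∀ α → value (x ↾ˣ α) ≢ 0#)
    positive-branch = dne λ ¬branch →
      let u , μu , _ , 0≢u = M2
      in 0≢u (sym (≤0⇒≡0 (cover-small (λ _ → 0#) 0-halving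
           (λ x → dne λ ¬null → ¬branch (x , λ α w≡0 → ¬null (α , λ _ → reflexive w≡0))) μu 0)))

    -- Splitting cones along the branch and halving positive elements.

    module _ (x : ^[ κ ] ƛ) (positive : ∀ α → value (x ↾ˣ α) ≢ 0#) where

      private
        -- The points of `N x α` that first leave `x` at β. For β < α the set is empty, so β may
        -- range over all of κ.
        Branch : ∣ κ ∣ → ∣ κ ∣ → Pred (^[ κ ] ƛ) ℓ
        Branch α β y = y ∈ N x α × y ∈ N x β × y β ≢ x β

        Branch-open : ∀ α β → Open (Branch α β)
        Branch-open α β = locally-open λ {y} (y∈Nα , y∈Nβ , yβ≢xβ) →
          let γ , <γ = bounded λ { zero → α ; (suc _) → β }
          in γ , λ z∈N →
            (λ (ζ , ζ<α) → trans (z∈N (ζ , κ.trans ζ<α (<γ 0))) (y∈Nα (ζ , ζ<α))) ,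
            (λ (ζ , ζ<β) → trans (z∈N (ζ , κ.trans ζ<β (<γ 1))) (y∈Nβ (ζ , ζ<β))) ,
            λ zβ≡xβ → yβ≢xβ (trans (sym (z∈N (β , <γ 1))) zβ≡xβ)

        Branch-disjoint : ∀ {α β γ} → β ≢ γ → Branch α β ⊥ Branch α γ
        Branch-disjoint {β = β} {γ} β≢γ ((_ , y∈Nβ , yβ≢xβ) , (_ , y∈Nγ , yγ≢xγ))
          with κ.compare β γ
        ... | tri< β<γ _ _ = yβ≢xβ (y∈Nγ (β , β<γ))
        ... | tri≈ _ β≡γ _ = β≢γ β≡γ
        ... | tri> _ _ γ<β = yγ≢xγ (y∈Nβ (γ , γ<β))

        N≐｛x｝∪Branches : ∀ α → ｛ x ｝ ∪ ⋃ ∣ κ ∣ (Branch α) ≐ N x α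
        N≐｛x｝∪Branches α =
          (λ { (inj₁ refl) _ → refl ; (inj₂ (_ , y∈Nα , _)) → y∈Nα }) ,
          λ {y} y∈Nα → case em {P = x ≡ y} of λ
            { (yes x≡y) → inj₁ x≡y
            ; (no x≢y)  →
              let β , yβ≢xβ , minimal = least κ (λ β → y β ≢ x β)
                    (¬∀⇒∃¬ λ y≗x → x≢y (sym (ext y≗x)))
              in inj₂ (β , y∈Nα , (λ (γ , γ<β) → dne (minimal γ γ<β)) , yβ≢xβ)
            }

        -- Otherwise `N x α` would be the null point `x` together with a disjoint union of κ ≤ δ
        -- null sets, hence null.
        nonnull-Branch : ∀ α → ∃[ β ] proj₁ (μ-open (Branch-open α β)) ≢ 0#
        nonnull-Branch α = ¬∀⇒∃¬ λ null →
          let a , μ⋃ = μ-open (⋃ᵍ (Branch-open α))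
              a≡0 = ≤0⇒≡0 (Halving.⋃-small (λ _ → 0#) 0-halving κ κ≤δ (Branch α)
                      (open⊆𝔐 ∘ Branch-open α) Branch-disjoint
                      (λ β μa _ → reflexive (trans (functional μa (proj₂ (μ-open (Branch-open α β))))
                                                   (null β)))
                      μ⋃ 0)
              μN = resp (N≐｛x｝∪Branches α)
                     (μ-∪ (proj₁ (continuous x)) (open⊆𝔐 (⋃ᵍ (Branch-open α)))
                     (λ { (refl , _ , _ , _ , xβ≢xβ) → xβ≢xβ refl }) (proj₂ (continuous x)) μ⋃)
          in positive α (trans (functional (μ-value (x ↾ˣ α)) μN) (trans (identityˡ a) a≡0))

      -- A cone `N x α` of measure below ε contains two disjoint non-null sets: a branch set leaving
      -- at some β, and a longer cone at `x`. The smaller of their measures is η.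
      halve : ∀ ε → 0# < ε → ∃[ η ] 0# < η × η + η ≤ ε
      halve ε 0<ε =
        let α , Nα≤ε , _ = small-cone x 0<ε
            β , b≢0 = nonnull-Branch α
            b , μb = μ-open (Branch-open α β)
            -- γ > α keeps `N x γ` inside `N x α`; γ > β keeps it disjoint from the branch set.
            γ , <γ = bounded λ { zero → α ; (suc _) → β }
            c = value (x ↾ˣ γ)
            open-γ = Cone-open (x ↾ˣ γ)
            disjoint : Branch α β ⊥ N x γ
            disjoint = λ ((_ , _ , yβ≢xβ) , y∈Nγ) → yβ≢xβ (y∈Nγ (β , <γ 1))
            sub : Branch α β ∪ N x γ ⊆ N x α
            sub = λ { (inj₁ (y∈Nα , _)) → y∈Nα
                    ; (inj₂ y∈Nγ) → N-antitone {x} (<γ 0) y∈Nγ }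
            b+c≤ε = ≤-trans (M3 (∪∈𝔐 (Branch-open α β) open-γ) (open⊆𝔐 (Cone-open (x ↾ˣ α))) sub
                      (μ-∪ (open⊆𝔐 (Branch-open α β)) (open⊆𝔐 open-γ) disjoint
                        μb (μ-value (x ↾ˣ γ)))
                      (μ-value (x ↾ˣ α))) Nα≤ε
        in case total b c of λ
          { (inj₁ b≤c) → b , ≢0⇒0< b≢0 , ≤-trans (+-mono-≤ (reflexive refl) b≤c) b+c≤ε
          ; (inj₂ c≤b) → c , ≢0⇒0< (positive γ) , ≤-trans (+-mono-≤ c≤b (reflexive refl)) b+c≤ε
          }
        where
        ∪∈𝔐 : ∀ {V W} → Open V → Open W → V ∪ W ∈ 𝔐
        ∪∈𝔐 {V} {W} open-V open-W = open⊆𝔐 (locally-open λ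
          { (inj₁ y∈V) → let α , N⊆V = open⇒nbhd open-V y∈V in α , inj₁ ∘ N⊆V
          ; (inj₂ y∈W) → let α , N⊆W = open⇒nbhd open-W y∈W in α , inj₂ ∘ N⊆W })

    -- The contradiction from iterated halving.

    no-continuous-measure : Empty
    no-continuous-measure =
      let x , positive = positive-branch
          u , μu , 0<u = M2
          -- The sequence starts at the measure of this cone, positive but strictly below μ(X).
          α₁ , w≤u , w≢u = small-cone x 0<u
          ε = halves x positive (value (x ↾ˣ α₁) , ≢0⇒0< (positive α₁))
          -- β exceeds, for each `n`, the length of a cone at `x` of measure below `ε n`, so the
          -- measure η of `N x β` is below them all.
          β , <β = bounded λ n → proj₁ (small-cone x (proj₂ (ε n)))
          η-small : ∀ n → value (x ↾ˣ β) ≤ proj₁ (ε n)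
          η-small = λ n → ≤-trans
            (mono-open (Cone-open (x ↾ˣ β)) (Cone-open _)
              (N-antitone {x} (<β n)) (μ-value _) (μ-value _))
            (proj₁ (proj₂ (small-cone x (proj₂ (ε n)))))
          -- Every point has a cone of measure below η, hence small; smallness of μ(X) at index 0
          -- bounds it by the starting value.
          u≤w = cover-small (proj₁ ∘ ε) (halves-halving x positive _)
                  (λ y → let γ , ≤η , _ = small-cone y (≢0⇒0< (positive β))
                         in γ , λ n → ≤-trans ≤η (η-small n)) μu 0
      in w≢u (antisym w≤u u≤w)
      where
      module _ (x : ^[ κ ] ƛ) (positive : ∀ α → value (x ↾ˣ α) ≢ 0#) where
        Positive = ∃ (0# <_)

        halves : Positive → ℕ → Positive
        halves ε₀ zero    = ε₀
        halves ε₀ (suc n) =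
          let ε , 0<ε = halves ε₀ n
              η , 0<η , _ = halve x positive ε 0<ε
          in η , 0<η

        halves-halving : ∀ ε₀ n → let ε = proj₁ ∘ halves ε₀ in ε (suc n) + ε (suc n) ≤ ε n
        halves-halving ε₀ n = proj₂ (proj₂ (halve x positive _ _))

corollary8p2 : (∀ {a} → ExcludedMiddle a) → (∀ {a b} → Extensionality a b) →
    ∀ {ℓ} (κ ƛ δ : Ordinal ℓ) →
    IsCardinal κ → Infinite ∣ κ ∣ →
    IsCardinal ƛ → Infinite ∣ ƛ ∣ →
    ∣ κ ∣ ≤ᶜ ∣ ƛ ∣ →
    IsRegular κ →
    IsCardinal δ → ∣ δ ∣ ↔ (^[< κ ] ƛ) →
    ∣ ƛ ∣ <ᶜ ∣ δ ∣ →
    ∀ {s r p m q} (𝕊 : PositivelyTotallyOrderedMonoid s r) (Σ𝕊 : InfinitarySum ℓ 𝕊 p)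
    (𝔐 : Pred (Pred (^[ κ ] ƛ) ℓ) m)
    (μ : Pred (^[ κ ] ƛ) ℓ → PositivelyTotallyOrderedMonoid.Carrier 𝕊 → Set q) →
    ¬ (IsWeakMeasureSpace δ (boundedTopology κ ƛ) 𝕊 Σ𝕊 𝔐 μ ×
    IsContinuous 𝕊 𝔐 μ)
corollary8p2 em ext κ ƛ δ _ _ _ ƛ-infinite κ≤ƛ κ-regular _ enum (ƛ≤δ , δ≰ƛ) _ _ _ _
  (space , continuous) =
  let ℕ≤ƛ = infinite⇒ℕ↣ ƛ-infinite
      -- Here δ > λ excludes κ = ω: an injection of `^[< κ ] ƛ` into λ would carry δ into λ.
      α , ℕ≤α = infinite-segment κ ƛ κ≤ƛ ℕ≤ƛ (λ ^<≤ƛ → δ≰ƛ (^<≤ƛ ↣-∘ ↔⇒↣ enum))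
  in NoMeasure.no-continuous-measure κ ƛ δ (ƛ≤δ ↣-∘ κ≤ƛ) (ƛ≤δ ↣-∘ ℕ≤ƛ) α
       (regular⇒bounded κ κ-regular ℕ≤α) enum space continuous
  where open Classical em ext
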